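{- Let $M=\{1^{p_1},2^{p_2},\dots,n^{p_n}\}$ be a multiset (with $n\ge1$ and all $p_i\ge 1$), and let $T\in\mathcal P_M$ be a weakly increasing tree on $M$. For any node $v$ of $T$, if $v\leadsto u$ (in $T$), then $$\mathsf{lev}_T(v)=\mathsf{lsw}_{\tilde\phi(T)}(u),\quad \mathsf{lsw}_T(v)=\mathsf{lev}_{\tilde\phi(T)}(u)\quad\text{and}\quad \mathsf{deg}_T(v)=\widetilde{\mathsf{deg}}_{\tilde\phi(T)}(u).$$ Consequently, the two septuples $$(\mathsf{Lev},\mathsf{Lsw},\mathsf{Bro},\mathsf{Par},\mathsf{Yle},\mathsf{leaf},\mathsf{int})\quad\text{and}\quad(\mathsf{Lsw},\mathsf{Lev},\mathsf{Par},\mathsf{Bro},\mathsf{Yle},\mathsf{int},\mathsf{leaf})$$ have the same distribution over $\mathcal P_M$.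
   Context: **Weakly increasing trees.** A plane tree is a rooted tree in which the children of each node are linearly ordered (left to right). For $M=\{1^{p_1},\dots,n^{p_n}\}$ with $p=p_1+\cdots+p_n$, a weakly increasing tree on $M$ is a plane tree with $p+1$ nodes labeled precisely by the elements of the multiset $M\cup\{0\}$ such that (i) labels along any path from the root to a leaf are weakly increasing, and (ii) the labels of the children of each node are weakly increasing from left to right. $\mathcal P_M$ is the set of these trees. A node without children is a leaf; otherwise it is internal. Nodes with the same parent are siblings; siblings to the left (right) of a node are its elder (younger) siblings. **Weakly increasing binary trees and $\tilde\phi$.** A binary tree is a rooted tree in which each node has at most one left child and at most one right child. $\mathcal B_M$ is the set of labeled binary trees whose labels form precisely $M$ and whose labels weakly increase along each path from the root to a leaf. The bijection $\varphi:\mathcal P_M\to\mathcal B_M$: the nodes of $\varphi(T)$ are the non-root nodes of $T$ with their labels; its root is the leftmost child of the root of $T$; for non-root nodes $x,y$, $y$ is the left child of $x$ in $\varphi(T)$ iff $y$ is the leftmost child of $x$ in $T$, and $y$ is the right child of $x$ in $\varphi(T)$ iff $x$ is the closest elder sibling of $y$ in $T$. For a binary tree $B$, $\phi(B)$ is its mirror image (same labeled nodes, left and right children exchanged). Put $\tilde\phi=\varphi^{ -1}\circ\phi\circ\varphi:\mathcal P_M\to\mathcal P_M$. The nodes of $T$ and of $\tilde\phi(T)$ are identified (root with root). **The relation $\leadsto$.** Let $B=\varphi(T)$. Add new nodes to $B$ so that every node of $B$ has exactly two children, obtaining the complement $\overline B$. Each added node is named after a node of $T$: if it is a left child of a node $v$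 of $B$, it is named $v'$; if it is a right child of a node $v$ of $B$, it is named $u'$, where $u$ is the parent of $v$ in $T$. Define $\overline{\phi(B)}$ in the same way using $\tilde\phi(T)$ in place of $T$. For every node $v$ of $T$ there is a unique node $u$ such that either $v'$ is the right child of $u$ in $\overline B$, or $u'$ is the right child of $v$ in $\overline{\phi(B)}$; one writes $v\leadsto u$. **Statistics of a node $v$ of $T$.** - $\mathsf{lev}_T(v)$: number of edges on the path from $v$ to the root. - $\mathsf{lsw}_T(v)$: the number of children of $v$ plus the number of edges attached to nodes other than $v$ on the path from $v$ to the root from the left-hand side (equivalently, the number of children of $v$ plus the total number of elder siblings of the non-root nodes on that path, $v$ included). - $\mathsf{deg}_T(v)$: number of children of $v$. - $\widetilde{\mathsf{deg}}_T(v)$: $0$ if $v$ is internal; $\mathsf{lev}_T(v)$ if $v$ is a leaf and no node on the path from $v$ to the root has elder siblings; otherwise the number of nodes from $v$ to the first node having elder siblings (both included) when walking from $v$ to the root. **Statistics of a tree $T\in\mathcal P_M$.** $\mathsf{leaf}(T)$ and $\mathsf{int}(T)$ are the numbers of leaves and internal nodes. $\mathsf{Lev}(T)$ and $\mathsf{Lsw}(T)$ are the multisets of $\mathsf{lev}_T(v)$ and of $\mathsf{lsw}_T(v)$ over all nodes $v$. $\mathsf{Bro}(T)$ is the multiset of labels of the repeated siblings, i.e. nodes having an elder sibling with the same label. $\mathsf{Par}(T)$ is the multiset of labels of the repeated parents, i.e. nodes having a child with the same label (one contribution per such node). $\mathsf{Yle}(T)$ is the multiset of labels of the young leaves, i.e.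 leaves that are the rightmost child of their parent. Two tuples of statistics have the same distribution over a finite set if every tuple of values is attained by equally many elements of the set. -}

module Defs where

open import Data.Fin.Base using (Fin; toℕ)
open import Data.List.Base
  using (List; []; _∷_; _∷ʳ_; _++_; map; length; filter; reverse; takeWhile;
         concatMap; replicate; allFin)
open import Data.List.Membership.Propositional using (_∈_)
open import Data.List.Relation.Binary.Permutation.Propositional using (_↭_; ↭-setoid)
open import Data.List.Relation.Unary.Any using (Any; here; there; any?)
open import Data.List.Relation.Unary.Linked using (Linked)
open import Data.List.Relation.Unary.Unique.Propositional using (Unique)
open import Data.Nat.Base using (ℕ; suc; _+_; _≤_; _<_)
open import Data.Nat.ListAction using (sum)
open import Data.Nat.Properties using (_≟_; _<?_)
open import Data.Product.Base using (∃; _×_; _,_)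
open import Data.Product.Relation.Binary.Pointwise.NonDependent using (_×ₛ_)
open import Data.Sum.Base using (_⊎_)
open import Data.Tree.Binary using (leaf; node) renaming (Tree to BinaryTree)
open import Data.Unit.Base using (⊤; tt)
open import Function.Base using (_∘_; id)
open import Function.Bundles using (_⇔_)
open import Level using (0ℓ)
open import Relation.Binary.Bundles using (Setoid)
open import Relation.Binary.PropositionalEquality using (_≡_; refl; cong; cong₂; setoid)
open import Relation.Nullary.Decidable using (Dec; yes; no; ¬?; _×-dec_)
open import Relation.Unary using (Pred; Decidable)

private
  variable
    A X N L : Set

data Tree (A : Set) : Set where
  node : A → List (Tree A) → Tree A

private
  variable
    a : A
    t : Tree A
    ts : List (Tree A)

rootLabel : Tree A → A
rootLabel (node a _) = a

subtrees : Tree A → List (Tree A)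
subtrees (node _ ts) = ts

-- A node is a position in the tree, so that distinct nodes with equal labels
-- are kept apart.  `Any Node ts` is the type of nodes of the forest `ts`; the
-- nodes of `ts` are exactly the non-root nodes of `node a ts`.
data Node {A : Set} : Tree A → Set where
  root  : ∀ {t} → Node t
  child : ∀ {a ts} → Any Node ts → Node (node a ts)

nodes  : (t : Tree A) → List (Node t)
nodesF : (ts : List (Tree A)) → List (Any Node ts)
nodes (node a ts) = root ∷ map child (nodesF ts)
nodesF []       = []
nodesF (t ∷ ts) = map here (nodes t) ++ map there (nodesF ts)

subtreeAt  : Node {A} t → Tree A
subtreeAtF : Any (Node {A}) ts → Tree A
subtreeAt {t = t} root = t
subtreeAt (child i)    = subtreeAtF i
subtreeAtF (here v)  = subtreeAt v
subtreeAtF (there i) = subtreeAtF i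

label : Node {A} t → A
label v = rootLabel (subtreeAt v)

-- The children of a node, and below its siblings, are represented by the
-- subtrees hanging from them, in left-to-right order.
children : Node {A} t → List (Tree A)
children v = subtrees (subtreeAt v)

-- In `elderSiblingsF es i` the list `es` holds the trees already passed to the
-- left within the current forest.
elderSiblings  : Node {A} t → List (Tree A)
elderSiblingsF : List (Tree A) → Any (Node {A}) ts → List (Tree A)
elderSiblings root      = []
elderSiblings (child i) = elderSiblingsF [] i
elderSiblingsF es (here root)       = es
elderSiblingsF es (here (child i))  = elderSiblingsF [] i
elderSiblingsF es (there {x = t} i) = elderSiblingsF (es ∷ʳ t) i

youngerSiblings  : Node {A} t → List (Tree A)
youngerSiblingsF : Any (Node {A}) ts → List (Tree A)
youngerSiblings root      = []
youngerSiblings (child i) = youngerSiblingsF i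
youngerSiblingsF (here {xs = ts} root) = ts
youngerSiblingsF (here (child i))      = youngerSiblingsF i
youngerSiblingsF (there i)             = youngerSiblingsF i

-- The non-root nodes on the path from a node to the root, starting at the node.
climb  : Node t → List (Node t)
climbF : Any Node ts → List (Any Node ts)
climb root      = []
climb (child i) = map child (climbF i)
climbF (here root)      = here root ∷ []
climbF (here (child i)) = map (here ∘ child) (climbF i) ∷ʳ here root
climbF (there i)        = map there (climbF i)

pathToRoot : Node t → List (Node t)
pathToRoot v = climb v ∷ʳ root

shift : Node (node a ts) → Node (node a (t ∷ ts))
shift root      = root
shift (child i) = child (there i)

-- The root has no parent; its value here is a dummy.
parent  : Node t → Node t
parentF : Any Node ts → Node (node a ts)
parent root      = root
parent (child i) = parentF i
parentF (here root)      = root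
parentF (here (child i)) = child (here (parentF i))
parentF (there i)        = shift (parentF i)

deg : Node t → ℕ
deg v = length (children v)

IsLeaf : Node t → Set
IsLeaf v = deg v ≡ 0

isLeaf? : (v : Node t) → Dec (IsLeaf v)
isLeaf? v = deg v ≟ 0

-- Each non-root node on the path contributes the edge to its parent.
lev : Node t → ℕ
lev v = length (climb v)

#elders : Node t → ℕ
#elders v = length (elderSiblings v)

lsw : Node t → ℕ
lsw v = deg v + sum (map #elders (climb v))

HasElder : Node t → Set
HasElder v = 0 < #elders v

hasElder? : (v : Node t) → Dec (HasElder v)
hasElder? v = 0 <? #elders v

-- In the last case the path is cut before the first node with elder siblings,
-- which `suc` counts in.
d̃eg : Node t → ℕ
d̃eg v with isLeaf? v | any? hasElder? (pathToRoot v)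
... | no  _ | _     = 0
... | yes _ | no  _ = lev v
... | yes _ | yes _ = suc (length (takeWhile (¬? ∘ hasElder?) (pathToRoot v)))

-- {1^{p₁}, …, n^{pₙ}}, with multisets represented by lists up to `_↭_`; the
-- element numbered by i : Fin n is 1 + toℕ i.
multiset : (n : ℕ) → (Fin n → ℕ) → List ℕ
multiset n p = concatMap (λ i → replicate (p i) (suc (toℕ i))) (allFin n)

labels : Tree A → List A
labels t = map label (nodes t)

record WeaklyIncreasing (M : List ℕ) (T : Tree ℕ) : Set where
  field
    labelled : labels T ↭ 0 ∷ M
    paths    : (v : Node T) → IsLeaf v → Linked _≤_ (map label (reverse (pathToRoot v)))
    siblings : (v : Node T) → Linked _≤_ (map rootLabel (children v))

-- The leaves of the library's binary trees stand for absent children.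
Binary : Set → Set
Binary A = BinaryTree A ⊤

-- The leftmost child becomes the left child and the next younger sibling the
-- right child.
φF : List (Tree A) → Binary A
φF []               = leaf tt
φF (node a us ∷ ts) = node (φF us) a (φF ts)

φ : Tree A → Binary A
φ (node _ ts) = φF ts

φ⁻¹F : Binary A → List (Tree A)
φ⁻¹F (leaf _)     = []
φ⁻¹F (node l a r) = node a (φ⁻¹F l) ∷ φ⁻¹F r

-- As φ forgets the root of a plane tree, its label has to be supplied again.
φ⁻¹ : A → Binary A → Tree A
φ⁻¹ a b = node a (φ⁻¹F b)

φ⁻¹F-φF : (ts : List (Tree A)) → φ⁻¹F (φF ts) ≡ ts
φ⁻¹F-φF []               = refl
φ⁻¹F-φF (node a us ∷ ts) = cong₂ (λ xs ys → node a xs ∷ ys) (φ⁻¹F-φF us) (φ⁻¹F-φF ts)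

φ⁻¹-φ : (t : Tree A) → φ⁻¹ (rootLabel t) (φ t) ≡ t
φ⁻¹-φ (node a ts) = cong (node a) (φ⁻¹F-φF ts)

φ-φ⁻¹ : (a : A) (b : Binary A) → φ (φ⁻¹ a b) ≡ b
φ-φ⁻¹ a (leaf _)     = refl
φ-φ⁻¹ a (node l x r) = cong₂ (λ y z → node y x z) (φ-φ⁻¹ a l) (φ-φ⁻¹ a r)

mirror : Binary A → Binary A
mirror (leaf _)     = leaf tt
mirror (node l a r) = node (mirror r) a (mirror l)

φ̃ : Tree A → Tree A
φ̃ t = φ⁻¹ (rootLabel t) (mirror (φ t))

data BNode {A : Set} : Binary A → Set where
  top   : ∀ {l a r} → BNode (node l a r)
  left  : ∀ {l a r} → BNode l → BNode (node l a r)
  right : ∀ {l a r} → BNode r → BNode (node l a r)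

φ-node : Any Node ts → BNode (φF ts)
φ-node (here {x = node _ _} root)      = top
φ-node (here {x = node _ _} (child i)) = left (φ-node i)
φ-node (there {x = node _ _} i)        = right (φ-node i)

mirror-node : {b : Binary A} → BNode b → BNode (mirror b)
mirror-node top       = top
mirror-node (left i)  = right (mirror-node i)
mirror-node (right i) = left (mirror-node i)

φ⁻¹-node : {b : Binary A} → BNode b → Any Node (φ⁻¹F b)
φ⁻¹-node top       = here root
φ⁻¹-node (left i)  = here (child (φ⁻¹-node i))
φ⁻¹-node (right i) = there (φ⁻¹-node i)

φ̃-node : Node t → Node (φ̃ t)
φ̃-node root      = root
φ̃-node (child i) = child (φ⁻¹-node (mirror-node (φ-node i)))

relabel  : (t : Tree A) → (Node t → X) → Tree X
relabelF : (ts : List (Tree A)) → (Any Node ts → X) → List (Tree X)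
relabel (node a ts) f = node (f root) (relabelF ts (f ∘ child))
relabelF []       f = []
relabelF (t ∷ ts) f = relabel t (f ∘ here) ∷ relabelF ts (f ∘ there)

-- φ t with every node labeled by itself instead of by its label in t.
φ-nodes : (t : Tree A) → Binary (Node t)
φ-nodes t = φ (relabel t id)

-- Fill the absent children of a binary tree with named nodes, written as
-- leaves: an absent left child of v is named (v)′ and an absent right child of
-- v is named (up v)′.  The first argument is the name used at the current
-- position if nothing is there.
fill : (N → N) → N → Binary N → BinaryTree N N
fill up x (leaf _)     = leaf x
fill up x (node l v r) = node (fill up v l) v (fill up (up v) r)

-- The complement of φ t: a leaf carrying u is the added node u′.  The initial
-- name is used only when t has a single node, so that φ t is empty.
complement : (t : Tree A) → BinaryTree (Node t) (Node t)
complement t = fill parent root (φ-nodes t)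

data _′IsRightChildOf_In_ (x : L) (y : N) : BinaryTree N L → Set where
  at-top   : ∀ {l}              → x ′IsRightChildOf y In node l y (leaf x)
  in-left  : ∀ {l z r} → x ′IsRightChildOf y In l → x ′IsRightChildOf y In node l z r
  in-right : ∀ {l z r} → x ′IsRightChildOf y In r → x ′IsRightChildOf y In node l z r

infix 4 _⇝_

_⇝_ : {t : Tree A} → Node t → Node t → Set
_⇝_ {t = t} v u = (v ′IsRightChildOf u In complement t)
                ⊎ (φ̃-node u ′IsRightChildOf φ̃-node v In complement (φ̃ t))

leaves internals : Tree A → ℕ
leaves t    = length (filter isLeaf? (nodes t))
internals t = length (filter (¬? ∘ isLeaf?) (nodes t))

Lev Lsw : Tree A → List ℕ
Lev t = map lev (nodes t)
Lsw t = map lsw (nodes t)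

RepeatedSibling RepeatedParent : {t : Tree ℕ} → Node t → Set
RepeatedSibling v = Any (λ s → rootLabel s ≡ label v) (elderSiblings v)
RepeatedParent  v = Any (λ s → rootLabel s ≡ label v) (children v)

-- A rightmost child is a non-root node (0 < lev v) without younger siblings.
YoungLeaf : {t : Tree ℕ} → Node t → Set
YoungLeaf v = IsLeaf v × 0 < lev v × length (youngerSiblings v) ≡ 0

repeatedSibling? : {t : Tree ℕ} → Decidable (RepeatedSibling {t})
repeatedSibling? v = any? (λ s → rootLabel s ≟ label v) (elderSiblings v)

repeatedParent? : {t : Tree ℕ} → Decidable (RepeatedParent {t})
repeatedParent? v = any? (λ s → rootLabel s ≟ label v) (children v)

youngLeaf? : {t : Tree ℕ} → Decidable (YoungLeaf {t})
youngLeaf? v = isLeaf? v ×-dec (0 <? lev v) ×-dec (length (youngerSiblings v) ≟ 0)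

Bro Par Yle : Tree ℕ → List ℕ
Bro t = map label (filter repeatedSibling? (nodes t))
Par t = map label (filter repeatedParent? (nodes t))
Yle t = map label (filter youngLeaf? (nodes t))

Septuples : Setoid 0ℓ 0ℓ
Septuples = M ×ₛ (M ×ₛ (M ×ₛ (M ×ₛ (M ×ₛ (setoid ℕ ×ₛ setoid ℕ)))))
  where M = ↭-setoid {A = ℕ}

HasCardinality : Pred X 0ℓ → ℕ → Set
HasCardinality P k = ∃ λ xs → Unique xs × (∀ x → x ∈ xs ⇔ P x) × length xs ≡ k

-- P is the set over which f and g are distributed.
SameDistribution : (V : Setoid 0ℓ 0ℓ) → Pred X 0ℓ → (f g : X → Setoid.Carrier V) → Set
SameDistribution V P f g =
  ∀ w → ∃ λ k → HasCardinality (λ x → P x × f x ≈ w) k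
              × HasCardinality (λ x → P x × g x ≈ w) k
  where open Setoid V using (_≈_)

{-# OPTIONS --safe #-}
-- In φ T, the level of a node is one more than the number of left edges on the
-- path to it, and the number of elder siblings along its path to the root is the
-- number of right edges; mirroring exchanges the two.  If v ⇝ u because u is the
-- rightmost child of v, then u is a leaf of φ̃ T, and the three equalities follow
-- by comparing v with u; otherwise the roles of T and φ̃ T are exchanged.
--
-- For the distributions, φ̃ is an involution of the weakly increasing trees, so it
-- suffices that it carries one septuple to the other.  Repeated siblings are the
-- right children in φ T with the label of their parent, repeated parents are the nodes
-- whose left child has their label, young leaves are the leaves of φ T, and leaves and
-- internal nodes are counted by the absent left and right children.
module Submission where

open import Defs
open import Data.Fin.Base using (Fin; zero)
open import Data.List.Base
  using (List; []; _∷_; _∷ʳ_; _++_; map; length; filter; reverse; takeWhile; cartesianProduct;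
         cartesianProductWith; deduplicate; allFin)
open import Data.List.Membership.DecPropositional using (_∈?_)
open import Data.List.Membership.Propositional using (_∈_)
open import Data.List.Membership.Propositional.Properties
  using (∈-map⁺; ∈-map⁻; ∈-filter⁺; ∈-filter⁻; ∈-deduplicate⁺; ∈-deduplicate⁻;
         ∈-cartesianProduct⁺; ∈-cartesianProductWith⁺; ∈-∃++)
open import Data.List.Properties
  using (++-assoc; ++-identityʳ; length-map; length-++; length-++-comm; length-++-≤ˡ;
         length-++-≤ʳ; map-++; map-∘; map-cong; filter-++; filter-≐; filter-reject; reverse-++;
         reverse-map)
open import Data.List.Relation.Binary.Permutation.Propositional
  using (_↭_; prep; swap; ↭-refl; ↭-sym; ↭-trans; ↭-reflexive; module PermutationReasoning)
open import Data.List.Relation.Binary.Permutation.Propositional.Properties as Perm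
  using (++⁺; ++-comm; ∈-resp-↭; All-resp-↭; drop-∷; ↭-length; ↭-empty-inv)
open import Data.List.Relation.Unary.All as All using (All; []; _∷_)
import Data.List.Relation.Unary.All.Properties as All
open import Data.List.Relation.Unary.Any using (Any; here; there; any?)
import Data.List.Relation.Unary.Any.Properties as Any
open import Data.List.Relation.Unary.Linked as Linked using (Linked; [-]; _∷_)
import Data.List.Relation.Unary.Unique.DecPropositional.Properties as DecUnique
import Data.List.Relation.Unary.Unique.Propositional.Properties as Unique
open import Data.Nat.Base using (ℕ; zero; suc; pred; _+_; _≤_; _<_; s≤s; z<s)
open import Data.Nat.ListAction using (sum)
open import Data.Nat.ListAction.Properties using (sum-++)
open import Data.Nat.Properties as ℕ
  using (_≟_; _≤?_; ≤-refl; ≤-trans; ≤-antisym; ≤-reflexive; n≤0⇒n≡0; n≮0; <⇒≢; 0≢1+n; +-comm;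
         +-assoc; +-suc; suc-injective)
open import Data.Product.Base using (∃; ∃-syntax; _×_; _,_; proj₁; proj₂)
open import Data.Sum.Base using (inj₁; inj₂)
open import Data.Tree.Binary using (leaf) renaming (node to bnode)
open import Data.Unit.Base using (⊤; tt)
open import Function.Base using (_∘_; id)
open import Function.Bundles using (mk⇔; module Equivalence)
open import Level using (0ℓ)
open import Relation.Binary.Bundles using (Setoid)
open import Relation.Binary.Definitions using (DecidableEquality)
open import Relation.Binary.PropositionalEquality
  using (_≡_; _≢_; refl; sym; trans; cong; cong₂; subst; module ≡-Reasoning)
open import Relation.Nullary.Decidable using (Dec; yes; no; ¬?; _×-dec_; map′)
open import Relation.Nullary.Negation using (¬_; contradiction)
open import Relation.Unary using (Pred; Decidable)

private
  variable
    A X Y N : Set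
    t : Tree A
    ts us : List (Tree A)
    M : List ℕ

-- Mirrored forests and their left and right edges.

mirrorF : List (Tree A) → List (Tree A)
mirrorF ts = φ⁻¹F (mirror (φF ts))

mirrorF-node : Any (Node {A}) ts → Any Node (mirrorF ts)
mirrorF-node i = φ⁻¹-node (mirror-node (φ-node i))

-- The left and right edges on the path from the root of φF ts to a node.
#lefts #rights : Any (Node {A}) ts → ℕ
#lefts (here root)      = 0
#lefts (here (child i)) = suc (#lefts i)
#lefts (there i)        = #lefts i
#rights (here root)      = 0
#rights (here (child i)) = #rights i
#rights (there i)        = suc (#rights i)

#lefts-mirror : (i : Any (Node {A}) ts) → #lefts (mirrorF-node i) ≡ #rights i
#lefts-mirror (here {x = node _ _} root)      = refl
#lefts-mirror (here {x = node _ _} (child i)) = #lefts-mirror i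
#lefts-mirror (there {x = node _ _} i)        = cong suc (#lefts-mirror i)

#rights-mirror : (i : Any (Node {A}) ts) → #rights (mirrorF-node i) ≡ #lefts i
#rights-mirror (here {x = node _ _} root)      = refl
#rights-mirror (here {x = node _ _} (child i)) = cong suc (#rights-mirror i)
#rights-mirror (there {x = node _ _} i)        = #rights-mirror i

-- In the following functions, k trees stand to the left of the forest.
#eldersF : ℕ → Any (Node {A}) ts → ℕ
#eldersF k (here root)      = k
#eldersF k (here (child i)) = #eldersF 0 i
#eldersF k (there i)        = #eldersF (suc k) i

elderCounts : ℕ → Any (Node {A}) ts → List ℕ
elderCounts k (here root)      = k ∷ []
elderCounts k (here (child i)) = elderCounts 0 i ∷ʳ k
elderCounts k (there i)        = elderCounts (suc k) i

-- Only the number of trees already passed matters, so the accumulator `es` can be replaced by its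
-- length.
elderCounts-climb : (es : List (Tree A)) (i : Any Node ts) →
  map (length ∘ elderSiblingsF es) (climbF i) ≡ elderCounts (length es) i
elderCounts-climb es (here root) = refl
elderCounts-climb es (here (child i)) = begin
  map f (map g (climbF i) ∷ʳ here root)         ≡⟨ map-++ f (map g (climbF i)) _ ⟩
  map f (map g (climbF i)) ∷ʳ length es         ≡⟨ cong (_∷ʳ length es) (map-∘ (climbF i)) ⟨
  map (length ∘ elderSiblingsF []) (climbF i) ∷ʳ length es
                                                ≡⟨ cong (_∷ʳ length es) (elderCounts-climb [] i) ⟩
  elderCounts 0 i ∷ʳ length es                  ∎
  where
  open ≡-Reasoning
  f = length ∘ elderSiblingsF es
  g = λ j → here (child j)
elderCounts-climb es (there {x = t} i) = begin
  map (length ∘ elderSiblingsF es) (map there (climbF i)) ≡⟨ map-∘ (climbF i) ⟨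
  map (length ∘ elderSiblingsF (es ∷ʳ t)) (climbF i)      ≡⟨ elderCounts-climb (es ∷ʳ t) i ⟩
  elderCounts (length (es ∷ʳ t)) i ≡⟨ cong (λ k → elderCounts k i) (length-++-comm es (t ∷ [])) ⟩
  elderCounts (suc (length es)) i  ∎
  where open ≡-Reasoning

climb-elders : ∀ {a} (i : Any (Node {A}) ts) →
  map #elders (climb (child {a = a} i)) ≡ elderCounts 0 i
climb-elders i = trans (sym (map-∘ (climbF i))) (elderCounts-climb [] i)

-- On the way down, a left edge starts a new entry and a right edge only raises the current one.
-- Hence the length of the list counts left edges and its sum counts right edges.
length-elderCounts : ∀ k (i : Any (Node {A}) ts) → length (elderCounts k i) ≡ suc (#lefts i)
length-elderCounts k (here root)      = refl
length-elderCounts k (here (child i)) =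
  trans (length-++-comm (elderCounts 0 i) (k ∷ [])) (cong suc (length-elderCounts 0 i))
length-elderCounts k (there i)        = length-elderCounts (suc k) i

sum-elderCounts : ∀ k (i : Any (Node {A}) ts) → sum (elderCounts k i) ≡ k + #rights i
sum-elderCounts k (here root)      = refl
sum-elderCounts k (here (child i)) = begin
  sum (elderCounts 0 i ∷ʳ k)        ≡⟨ sum-++ (elderCounts 0 i) (k ∷ []) ⟩
  sum (elderCounts 0 i) + (k + 0)   ≡⟨ cong₂ _+_ (sum-elderCounts 0 i) (ℕ.+-identityʳ k) ⟩
  #rights i + k                     ≡⟨ +-comm (#rights i) k ⟩
  k + #rights i                     ∎
  where open ≡-Reasoning
sum-elderCounts k (there i)        = trans (sum-elderCounts (suc k) i) (sym (+-suc k (#rights i)))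

-- Levels, `lsw` and degrees of nodes and their parents.

lev-child : ∀ {a} (i : Any (Node {A}) ts) → lev (child {a = a} i) ≡ suc (#lefts i)
lev-child {a = a} i = begin
  length (climb (child {a = a} i))                ≡⟨ length-map #elders (climb (child {a = a} i)) ⟨
  length (map #elders (climb (child {a = a} i)))  ≡⟨ cong length (climb-elders i) ⟩
  length (elderCounts 0 i)                        ≡⟨ length-elderCounts 0 i ⟩
  suc (#lefts i)                                  ∎
  where open ≡-Reasoning

lsw-child : ∀ {a} (i : Any (Node {A}) ts) →
  lsw (child {a = a} i) ≡ deg (child {a = a} i) + #rights i
lsw-child {a = a} i = cong (deg (child {a = a} i) +_)
  (trans (cong sum (climb-elders i)) (sum-elderCounts 0 i))

lev-shift : ∀ {a} (v : Node (node a ts)) → lev (shift {t = t} v) ≡ lev v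
lev-shift root      = refl
lev-shift {t = t} {a = a} (child i) =
  trans (lev-child {a = a} (there {x = t} i)) (sym (lev-child {a = a} i))

lsw-shift : ∀ {a} (v : Node (node a ts)) → lsw (shift {t = t} v) ≡ suc (lsw v)
lsw-shift root      = refl
lsw-shift {t = t} {a = a} (child i) = begin
  lsw (child {a = a} (there {x = t} i))          ≡⟨ lsw-child {a = a} (there {x = t} i) ⟩
  deg (child {a = a} i) + suc (#rights i)        ≡⟨ +-suc (deg (child {a = a} i)) (#rights i) ⟩
  suc (deg (child {a = a} i) + #rights i)        ≡⟨ cong suc (lsw-child {a = a} i) ⟨
  suc (lsw (child {a = a} i))                    ∎
  where open ≡-Reasoning

lev-here : ∀ {a} (v : Node t) → lev (child {a = a} {ts = t ∷ ts} (here v)) ≡ suc (lev v)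
lev-here         root              = refl
lev-here {ts = ts} {a = a} (child {a = b} i) =
  trans (lev-child {a = a} (here {xs = ts} (child {a = b} i))) (cong suc (sym (lev-child {a = b} i)))

lsw-here : ∀ {a} (v : Node t) → lsw (child {a = a} {ts = t ∷ ts} (here v)) ≡ lsw v
lsw-here         root              = refl
lsw-here {ts = ts} {a = a} (child {a = b} i) =
  trans (lsw-child {a = a} (here {xs = ts} (child {a = b} i))) (sym (lsw-child {a = b} i))

lev-parent : ∀ {a} (i : Any (Node {A}) ts) → lev (parent (child {a = a} i)) ≡ #lefts i
lev-parent         (here root)              = refl
lev-parent {a = a} (here {xs = ts} (child {a = b} i)) =
  trans (lev-here {ts = ts} {a = a} (parent (child {a = b} i))) (cong suc (lev-parent {a = b} i))
lev-parent {a = a} (there i)                = trans (lev-shift (parent (child {a = a} i))) (lev-parent {a = a} i)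

-- The children of the parent are `i` and its elder siblings. The elder siblings account for the
-- right edges between the leftmost child and `i`, the remaining right edges lie above the parent,
-- and `suc` counts `i` itself.
lsw-parent : ∀ {a} (i : Any (Node {A}) ts) → youngerSiblingsF i ≡ [] →
  lsw (parent (child {a = a} i)) ≡ suc (#rights i)
lsw-parent         (here root)              refl = refl
lsw-parent {a = a} (here {xs = ts} (child {a = b} i)) eq =
  trans (lsw-here {ts = ts} {a = a} (parent (child {a = b} i))) (lsw-parent {a = b} i eq)
lsw-parent {a = a} (there i)                eq   =
  trans (lsw-shift (parent (child {a = a} i))) (cong suc (lsw-parent {a = a} i eq))

-- The degree of a node when k more trees are added below the root.
degF : ℕ → Node {A} t → ℕ
degF k (root {t = t})      = k + length (subtrees t)
degF k (child {a = a} i)   = deg (child {a = a} i)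

degF-0 : (v : Node t) → degF 0 v ≡ deg v
degF-0 root      = refl
degF-0 (child i) = refl

degF-shift : ∀ {a} k (v : Node (node a ts)) → degF k (shift {t = t} v) ≡ degF (suc k) v
degF-shift k root      = +-suc k _
degF-shift k (child i) = refl

deg-here : ∀ {a} (v : Node t) → deg (child {a = a} {ts = t ∷ ts} (here v)) ≡ deg v
deg-here root      = refl
deg-here (child i) = refl

degF-parent : ∀ {a} k (i : Any (Node {A}) ts) → youngerSiblingsF i ≡ [] →
  degF k (parent (child {a = a} i)) ≡ suc (#eldersF k i)
degF-parent         k (here root)              refl = +-comm k 1
degF-parent {a = a} k (here {xs = ts} (child {a = b} i)) eq = begin
  deg (child {a = a} {ts = _ ∷ ts} (here (parent (child {a = b} i))))
                                    ≡⟨ deg-here {ts = ts} {a = a} (parent (child {a = b} i)) ⟩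
  deg (parent (child {a = b} i))    ≡⟨ degF-0 (parent (child {a = b} i)) ⟨
  degF 0 (parent (child {a = b} i)) ≡⟨ degF-parent 0 i eq ⟩
  suc (#eldersF 0 i)                ∎
  where open ≡-Reasoning
degF-parent {a = a} k (there i)                eq =
  trans (degF-shift k (parent (child {a = a} i))) (degF-parent (suc k) i eq)

deg-parent : ∀ {a} (i : Any (Node {A}) ts) → youngerSiblingsF i ≡ [] →
  deg (parent (child {a = a} i)) ≡ suc (#eldersF 0 i)
deg-parent i eq = trans (sym (degF-0 (parent (child i)))) (degF-parent 0 i eq)

-- The statistic `d̃eg` along a path.

-- This is `d̃eg` of a leaf in terms of the elder counts on its path: the number of entries up to
-- and including the first positive one, or of all entries if every one is zero.
untilPositive : List ℕ → ℕ
untilPositive []           = 0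
untilPositive (zero  ∷ ks) = suc (untilPositive ks)
untilPositive (suc _ ∷ ks) = 1

-- The root has no elder siblings, so the node that stops the walk lies in `vs`.
takeWhile-eldest : (vs : List (Node {A} t)) → Any HasElder (vs ∷ʳ root) →
  suc (length (takeWhile (¬? ∘ hasElder?) (vs ∷ʳ root))) ≡ untilPositive (map #elders vs)
takeWhile-eldest []       (here ())
takeWhile-eldest (v ∷ vs) p with #elders v in eq | p
... | zero  | here q  = contradiction (subst (0 <_) eq q) λ ()
... | zero  | there q = cong suc (takeWhile-eldest vs q)
... | suc _ | _       = refl

untilPositive-eldest : (vs : List (Node {A} t)) → ¬ Any HasElder (vs ∷ʳ root) →
  length vs ≡ untilPositive (map #elders vs)
untilPositive-eldest []       ¬p = refl
untilPositive-eldest (v ∷ vs) ¬p with #elders v in eq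
... | zero  = cong suc (untilPositive-eldest vs (¬p ∘ there))
... | suc _ = contradiction (here (subst (0 <_) (sym eq) z<s)) ¬p

d̃eg-leaf : (v : Node {A} t) → IsLeaf v → d̃eg v ≡ untilPositive (map #elders (climb v))
d̃eg-leaf v l with isLeaf? v | any? hasElder? (pathToRoot v)
... | no ¬l | _      = contradiction l ¬l
... | yes _ | no ¬p  = untilPositive-eldest (climb v) ¬p
... | yes _ | yes p  = takeWhile-eldest (climb v) p

d̃eg-internal : (v : Node {A} t) → ¬ IsLeaf v → d̃eg v ≡ 0
d̃eg-internal v ¬l with isLeaf? v
... | no  _ = refl
... | yes l = contradiction l ¬l

-- The list ks stands for the elder counts further up the path.
untilPositive-mirror : ∀ k ks (i : Any (Node {A}) ts) →
  untilPositive (elderCounts k (mirrorF-node i) ++ ks) ≡ suc (#eldersF (pred (untilPositive (k ∷ ks))) i)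
untilPositive-mirror zero    ks (here {x = node _ _} root) = refl
untilPositive-mirror (suc _) ks (here {x = node _ _} root) = refl
-- A left edge turns into a right one: the current entry becomes positive, and the count of elder
-- siblings of `i` restarts at 0.
untilPositive-mirror zero    ks (here {x = node _ _} (child i)) = untilPositive-mirror 1 ks i
untilPositive-mirror (suc k) ks (here {x = node _ _} (child i)) = untilPositive-mirror (suc (suc k)) ks i
-- A right edge turns into a left one: `k` joins `ks` below a new entry 0, while `i` gains an elder
-- sibling. The case split on `k` lets `untilPositive (k ∷ ks)` compute to a successor.
untilPositive-mirror zero    ks (there {x = node _ _} i) =
  trans (cong untilPositive (++-assoc (elderCounts 0 (mirrorF-node i)) (0 ∷ []) ks))
        (untilPositive-mirror 0 (0 ∷ ks) i)
untilPositive-mirror (suc k) ks (there {x = node _ _} i) =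
  trans (cong untilPositive (++-assoc (elderCounts 0 (mirrorF-node i)) (suc k ∷ []) ks))
        (untilPositive-mirror 0 (suc k ∷ ks) i)

-- Added right children and the relation `⇝`.

-- In `φF ts` the left subtree of a node encodes its children and the right subtree its younger
-- siblings, so mirroring exchanges these two forests.
children-mirror : ∀ {a b} (i : Any (Node {A}) ts) →
  children (child {a = a} (mirrorF-node i)) ≡ mirrorF (youngerSiblings (child {a = b} i))
children-mirror (here {x = node _ _} root)      = refl
children-mirror {a = a} (here {x = node c _} (child i)) = children-mirror {a = a} {b = c} i
children-mirror {b = b} (there {x = node c _} i) = children-mirror {a = c} {b = b} i

youngerSiblings-mirror : ∀ {a b} (i : Any (Node {A}) ts) →
  youngerSiblings (child {a = a} (mirrorF-node i)) ≡ mirrorF (children (child {a = b} i))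
youngerSiblings-mirror (here {x = node _ _} root)      = refl
youngerSiblings-mirror {a = a} (here {x = node c _} (child i)) = youngerSiblings-mirror {a = a} {b = c} i
youngerSiblings-mirror {b = b} (there {x = node c _} i) = youngerSiblings-mirror {a = c} {b = b} i

mirrorF≡[] : (ts : List (Tree A)) → mirrorF ts ≡ [] → ts ≡ []
mirrorF≡[] [] eq = refl
mirrorF≡[] (node _ _ ∷ _) ()

-- A right child is added exactly where there is no next sibling, and `fill` names it by `up` of the
-- node above it. The naming `f` is arbitrary so that the induction can pass to subforests.
rightChild⇒rightmost : ∀ (ts : List (Tree A)) (f : Any Node ts → N) {up q x y} →
  x ′IsRightChildOf y In fill up q (φF (relabelF ts f)) →
  ∃[ i ] youngerSiblingsF i ≡ [] × y ≡ f i × x ≡ up (f i)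
rightChild⇒rightmost (node a us ∷ [])      f at-top       = here root , refl , refl , refl
rightChild⇒rightmost (node a us ∷ [])      f (in-left p)
  with i , eq , y≡ , x≡ ← rightChild⇒rightmost us (λ j → f (here (child j))) p
  = here (child i) , eq , y≡ , x≡
rightChild⇒rightmost (node a us ∷ node _ _ ∷ _)  f (in-left p)
  with i , eq , y≡ , x≡ ← rightChild⇒rightmost us (λ j → f (here (child j))) p
  = here (child i) , eq , y≡ , x≡
rightChild⇒rightmost (node a us ∷ ts@(node _ _ ∷ _)) f (in-right p)
  -- Any name can stand for `q`: as `ts` is nonempty, its top position is taken by a node.
  with i , eq , y≡ , x≡ ← rightChild⇒rightmost ts (λ j → f (there j)) {q = f (here root)} p
  = there i , eq , y≡ , x≡

-- For the degrees, the elder siblings of `i` are the right edges directly above it. Mirrored, these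
-- are the steps from leftmost children to their parents that `d̃eg u` counts.
rightmostChild⇒stats : ∀ {a} (i : Any (Node {A}) ts) → youngerSiblingsF i ≡ [] →
  let v = parent (child {a = a} i); u = φ̃-node (child {a = a} i) in
  (lev v ≡ lsw u) × (lsw v ≡ lev u) × (deg v ≡ d̃eg u)
rightmostChild⇒stats {a = a} i eq = lev≡lsw , lsw≡lev , deg≡d̃eg
  where
  open ≡-Reasoning
  v = parent (child {a = a} i)
  u = φ̃-node (child {a = a} i)

  leaf-u : IsLeaf u
  leaf-u = cong length (trans (children-mirror {a = a} {b = a} i) (cong mirrorF eq))

  lev≡lsw : lev v ≡ lsw u
  lev≡lsw = begin
    lev v                                 ≡⟨ lev-parent {a = a} i ⟩
    #lefts i                              ≡⟨ #rights-mirror i ⟨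
    #rights (mirrorF-node i)              ≡⟨ cong (_+ #rights (mirrorF-node i)) leaf-u ⟨
    deg u + #rights (mirrorF-node i)      ≡⟨ lsw-child {a = a} (mirrorF-node i) ⟨
    lsw u                                 ∎

  lsw≡lev : lsw v ≡ lev u
  lsw≡lev = begin
    lsw v                                 ≡⟨ lsw-parent {a = a} i eq ⟩
    suc (#rights i)                       ≡⟨ cong suc (#lefts-mirror i) ⟨
    suc (#lefts (mirrorF-node i))         ≡⟨ lev-child {a = a} (mirrorF-node i) ⟨
    lev u                                 ∎

  deg≡d̃eg : deg v ≡ d̃eg u
  deg≡d̃eg = begin
    deg v                                              ≡⟨ deg-parent {a = a} i eq ⟩
    suc (#eldersF 0 i)                                 ≡⟨ untilPositive-mirror 0 [] i ⟨
    untilPositive (elderCounts 0 (mirrorF-node i) ++ []) ≡⟨ cong untilPositive (++-identityʳ _) ⟩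
    untilPositive (elderCounts 0 (mirrorF-node i))     ≡⟨ cong untilPositive (climb-elders {a = a} (mirrorF-node i)) ⟨
    untilPositive (map #elders (climb u))              ≡⟨ d̃eg-leaf u leaf-u ⟨
    d̃eg u                                              ∎

-- The image of `v` has no younger siblings, so `v` is a leaf; its image has `u` as parent, so `u`
-- is internal. Thus `deg v` and `d̃eg u` both vanish.
leaf⇒stats : ∀ {a} (i : Any (Node {A}) ts) → youngerSiblingsF (mirrorF-node i) ≡ [] →
  let v = child {a = a} i; u = parent (φ̃-node v) in
  (lev v ≡ lsw u) × (lsw v ≡ lev u) × (deg v ≡ d̃eg u)
leaf⇒stats {a = a} i eq = lev≡lsw , lsw≡lev , deg≡d̃eg
  where
  open ≡-Reasoning
  v = child {a = a} i
  j = mirrorF-node i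
  u = parent (child {a = a} j)

  leaf-v : IsLeaf v
  leaf-v = cong length
    (mirrorF≡[] (children v) (trans (sym (youngerSiblings-mirror {a = a} {b = a} i)) eq))

  lev≡lsw : lev v ≡ lsw u
  lev≡lsw = begin
    lev v             ≡⟨ lev-child {a = a} i ⟩
    suc (#lefts i)    ≡⟨ cong suc (#rights-mirror i) ⟨
    suc (#rights j)   ≡⟨ lsw-parent {a = a} j eq ⟨
    lsw u             ∎

  lsw≡lev : lsw v ≡ lev u
  lsw≡lev = begin
    lsw v               ≡⟨ lsw-child {a = a} i ⟩
    deg v + #rights i   ≡⟨ cong (_+ #rights i) leaf-v ⟩
    #rights i           ≡⟨ #lefts-mirror i ⟨
    #lefts j            ≡⟨ lev-parent {a = a} j ⟨
    lev u               ∎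

  internal-u : ¬ IsLeaf u
  internal-u l with () ← trans (sym l) (deg-parent {a = a} j eq)

  deg≡d̃eg : deg v ≡ d̃eg u
  deg≡d̃eg = trans leaf-v (sym (d̃eg-internal u internal-u))

⇝-stats : {t : Tree A} {v u : Node t} → v ⇝ u →
  (lev v ≡ lsw (φ̃-node u)) × (lsw v ≡ lev (φ̃-node u)) × (deg v ≡ d̃eg (φ̃-node u))
⇝-stats {t = node a ts} (inj₁ p)
  with i , eq , refl , refl ← rightChild⇒rightmost ts child p
  = rightmostChild⇒stats i eq
-- The node above an added one lies in the binary tree, so it is not the root.
⇝-stats {t = node a ts} {v = root} (inj₂ p)
  with _ , _ , () , _ ← rightChild⇒rightmost (mirrorF ts) child p
⇝-stats {t = node a ts} {v = child i} {u} (inj₂ p)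
  with j , eq , refl , u≡ ← rightChild⇒rightmost (mirrorF ts) child p
  -- The goal involves `u` only through `φ̃-node u`, which `u≡` identifies as the parent of
  -- `φ̃-node v`.
  rewrite u≡ = leaf⇒stats {a = a} i eq

-- The involution `φ̃`.

mirror-involutive : (b : Binary A) → mirror (mirror b) ≡ b
mirror-involutive (leaf _)      = refl
mirror-involutive (bnode l a r) = cong₂ (λ l r → bnode l a r) (mirror-involutive l) (mirror-involutive r)

φ̃-involutive : (t : Tree A) → φ̃ (φ̃ t) ≡ t
φ̃-involutive (node a ts) = begin
  φ⁻¹ a (mirror (φ (φ⁻¹ a (mirror (φF ts)))))  ≡⟨ cong (φ⁻¹ a ∘ mirror) (φ-φ⁻¹ a (mirror (φF ts))) ⟩
  φ⁻¹ a (mirror (mirror (φF ts)))              ≡⟨ cong (φ⁻¹ a) (mirror-involutive (φF ts)) ⟩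
  φ⁻¹ a (φF ts)                                ≡⟨ φ⁻¹-φ (node a ts) ⟩
  node a ts                                    ∎
  where open ≡-Reasoning

-- Collecting values over the nodes of a forest.

labelF : Any (Node {A}) ts → A
labelF i = rootLabel (subtreeAtF i)

childrenF : Any (Node {A}) ts → List (Tree A)
childrenF i = subtrees (subtreeAtF i)

-- The list of nodes splits as `φF` does into top, left and right part. This turns statistics over
-- nodes into recursions on forests, on which `mirrorF` acts by exchanging the last two parts.
map-nodesF : ∀ (a : A) us ts (f : Any Node (node a us ∷ ts) → X) →
  map f (nodesF (node a us ∷ ts)) ≡
  f (here root) ∷ map (λ i → f (here (child i))) (nodesF us) ++ map (λ i → f (there i)) (nodesF ts)
map-nodesF a us ts f = cong (f (here root) ∷_) (begin
  map f (map here (map child (nodesF us)) ++ map there (nodesF ts))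
    ≡⟨ map-++ f (map here (map child (nodesF us))) (map there (nodesF ts)) ⟩
  map f (map here (map child (nodesF us))) ++ map f (map there (nodesF ts))
    ≡⟨ cong₂ _++_ (trans (map-∘ (nodesF us)) (map-∘ (map child (nodesF us)))) (map-∘ (nodesF ts)) ⟨
  map (λ i → f (here (child i))) (nodesF us) ++ map (λ i → f (there i)) (nodesF ts) ∎)
  where open ≡-Reasoning

select : {P : Pred X 0ℓ} → Decidable P → (X → Y) → List X → List Y
select P? f xs = map f (filter P? xs)

module _ {P : Pred X 0ℓ} (P? : Decidable P) (f : X → Y) where

  select-++ : ∀ xs ys → select P? f (xs ++ ys) ≡ select P? f xs ++ select P? f ys
  select-++ xs ys = trans (cong (map f) (filter-++ P? xs ys)) (map-++ f (filter P? xs) (filter P? ys))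

  select-map : {Z : Set} (g : Z → X) (zs : List Z) →
    select P? f (map g zs) ≡ select (λ z → P? (g z)) (λ z → f (g z)) zs
  select-map g []       = refl
  select-map g (z ∷ zs) with P? (g z)
  ... | yes _ = cong (f (g z) ∷_) (select-map g zs)
  ... | no  _ = select-map g zs

select-nodesF : ∀ (a : A) us ts {P : Pred (Any Node (node a us ∷ ts)) 0ℓ} (P? : Decidable P) (f : _ → X) →
  select P? f (nodesF (node a us ∷ ts)) ≡
  select P? f (here root ∷ []) ++
    select (λ i → P? (here (child i))) (λ i → f (here (child i))) (nodesF us) ++
    select (λ i → P? (there i)) (λ i → f (there i)) (nodesF ts)
select-nodesF a us ts P? f = begin
  select P? f (here root ∷ map here (map child (nodesF us)) ++ map there (nodesF ts))
    ≡⟨ select-++ P? f (here root ∷ []) _ ⟩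
  select P? f (here root ∷ []) ++ select P? f (map here (map child (nodesF us)) ++ map there (nodesF ts))
    ≡⟨ cong (select P? f (here root ∷ []) ++_) (trans
         (select-++ P? f (map here (map child (nodesF us))) (map there (nodesF ts)))
         (cong₂ _++_
           (trans (select-map P? f here (map child (nodesF us)))
                  (select-map (λ v → P? (here v)) (λ v → f (here v)) child (nodesF us)))
           (select-map P? f there (nodesF ts)))) ⟩
  select P? f (here root ∷ []) ++
    select (λ i → P? (here (child i))) (λ i → f (here (child i))) (nodesF us) ++
    select (λ i → P? (there i)) (λ i → f (there i)) (nodesF ts) ∎
  where open ≡-Reasoning

select-root : ∀ {a : A} {P : Pred (Node (node a ts)) 0ℓ} (P? : Decidable P) (f : _ → X) → ¬ P root →
  select P? f (nodes (node a ts)) ≡ select (λ i → P? (child i)) (λ i → f (child i)) (nodesF ts)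
select-root {ts = ts} P? f ¬p =
  trans (cong (map f) (filter-reject P? ¬p)) (select-map P? f child (nodesF ts))

-- Lev and Lsw

levels : ℕ → List (Tree A) → List ℕ
levels c []               = []
levels c (node a us ∷ ts) = c ∷ levels (suc c) us ++ levels c ts

-- Here `e` is the number of right edges leading to the forest, just as `c` in `levels` is the level
-- of its trees.
switches : ℕ → List (Tree A) → List ℕ
switches e []               = []
switches e (node a us ∷ ts) = length us + e ∷ switches e us ++ switches (suc e) ts

levels-nodesF : ∀ c (ts : List (Tree A)) → map (λ i → c + #lefts i) (nodesF ts) ≡ levels c ts
levels-nodesF c []               = refl
levels-nodesF c (node a us ∷ ts) = trans (map-nodesF a us ts (λ i → c + #lefts i))
  (cong₂ _∷_ (+-comm c 0) (cong₂ _++_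
    (trans (map-cong (λ i → +-suc c (#lefts i)) (nodesF us)) (levels-nodesF (suc c) us))
    (levels-nodesF c ts)))

switches-nodesF : ∀ e (ts : List (Tree A)) →
  map (λ i → length (childrenF i) + (e + #rights i)) (nodesF ts) ≡ switches e ts
switches-nodesF e []               = refl
switches-nodesF e (node a us ∷ ts) = trans (map-nodesF a us ts (λ i → length (childrenF i) + (e + #rights i)))
  (cong₂ _∷_ (cong (length us +_) (+-comm e 0)) (cong₂ _++_
    (switches-nodesF e us)
    (trans (map-cong (λ i → cong (length (childrenF i) +_) (+-suc e (#rights i))) (nodesF ts))
           (switches-nodesF (suc e) ts))))

Lev-levels : ∀ (a : A) ts → Lev (node a ts) ≡ 0 ∷ levels 1 ts
Lev-levels a ts = cong (0 ∷_) (begin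
  map lev (map child (nodesF ts))             ≡⟨ map-∘ (nodesF ts) ⟨
  map (λ i → lev (child {a = a} i)) (nodesF ts) ≡⟨ map-cong lev-child (nodesF ts) ⟩
  map (λ i → suc (#lefts i)) (nodesF ts)      ≡⟨ levels-nodesF 1 ts ⟩
  levels 1 ts                                 ∎)
  where open ≡-Reasoning

Lsw-switches : ∀ (a : A) ts → Lsw (node a ts) ≡ length ts + 0 ∷ switches 0 ts
Lsw-switches a ts = cong (length ts + 0 ∷_) (begin
  map lsw (map child (nodesF ts))             ≡⟨ map-∘ (nodesF ts) ⟨
  map (λ i → lsw (child {a = a} i)) (nodesF ts) ≡⟨ map-cong lsw-child (nodesF ts) ⟩
  map (λ i → length (childrenF i) + #rights i) (nodesF ts) ≡⟨ switches-nodesF 0 ts ⟩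
  switches 0 ts                               ∎)
  where open ≡-Reasoning

-- The head `length ts + e` on the right is the `lsw` of the parent of the forest. In the induction,
-- the instance for `us` supplies the entry of the new node and the instance for `ts` that of the
-- parent, since `length ts + suc e` equals `suc (length ts) + e`.
levels-mirror : ∀ e (ts : List (Tree A)) →
  e ∷ levels (suc e) (mirrorF ts) ↭ length ts + e ∷ switches e ts
levels-mirror e []               = ↭-refl
levels-mirror e (node a us ∷ ts) = begin
  e ∷ suc e ∷ levels (suc (suc e)) (mirrorF ts) ++ levels (suc e) (mirrorF us)
    ↭⟨ prep e (++-comm (suc e ∷ levels (suc (suc e)) (mirrorF ts)) _) ⟩
  (e ∷ levels (suc e) (mirrorF us)) ++ (suc e ∷ levels (suc (suc e)) (mirrorF ts))
    ↭⟨ ++⁺ (levels-mirror e us) (levels-mirror (suc e) ts) ⟩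
  length us + e ∷ switches e us ++ (length ts + suc e ∷ switches (suc e) ts)
    ↭⟨ prep _ (Perm.shift (length ts + suc e) (switches e us) _) ⟩
  length us + e ∷ length ts + suc e ∷ switches e us ++ switches (suc e) ts
    ↭⟨ swap _ _ ↭-refl ⟩
  length ts + suc e ∷ length us + e ∷ switches e us ++ switches (suc e) ts
    ≡⟨ cong (_∷ length us + e ∷ switches e us ++ switches (suc e) ts) (+-suc (length ts) e) ⟩
  suc (length ts) + e ∷ length us + e ∷ switches e us ++ switches (suc e) ts ∎
  where open PermutationReasoning

Lev-φ̃ : (t : Tree A) → Lev (φ̃ t) ↭ Lsw t
Lev-φ̃ (node a ts) = begin
  Lev (node a (mirrorF ts))         ≡⟨ Lev-levels a (mirrorF ts) ⟩
  0 ∷ levels 1 (mirrorF ts)         ↭⟨ levels-mirror 0 ts ⟩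
  length ts + 0 ∷ switches 0 ts     ≡⟨ Lsw-switches a ts ⟨
  Lsw (node a ts)                   ∎
  where open PermutationReasoning

-- Leaves and internal nodes

count : {P : Pred X 0ℓ} → Decidable P → List X → ℕ
count P? xs = length (filter P? xs)

module _ {P : Pred X 0ℓ} (P? : Decidable P) where

  count-++ : ∀ xs ys → count P? (xs ++ ys) ≡ count P? xs + count P? ys
  count-++ xs ys = trans (cong length (filter-++ P? xs ys)) (length-++ (filter P? xs))

  count-map : (g : Y → X) (ys : List Y) → count P? (map g ys) ≡ count (λ y → P? (g y)) ys
  count-map g []       = refl
  count-map g (y ∷ ys) with P? (g y)
  ... | yes _ = cong suc (count-map g ys)
  ... | no  _ = count-map g ys

count-nodesF : ∀ (a : A) us ts {P : Pred (Any Node (node a us ∷ ts)) 0ℓ} (P? : Decidable P) →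
  count P? (nodesF (node a us ∷ ts)) ≡
  count P? (here root ∷ []) +
    (count (λ i → P? (here (child i))) (nodesF us) + count (λ i → P? (there i)) (nodesF ts))
count-nodesF a us ts P? = begin
  count P? (here root ∷ map here (map child (nodesF us)) ++ map there (nodesF ts))
    ≡⟨ count-++ P? (here root ∷ []) (map here (map child (nodesF us)) ++ map there (nodesF ts)) ⟩
  count P? (here root ∷ []) + count P? (map here (map child (nodesF us)) ++ map there (nodesF ts))
    ≡⟨ cong (count P? (here root ∷ []) +_) (trans
         (count-++ P? (map here (map child (nodesF us))) (map there (nodesF ts)))
         (cong₂ _+_
           (trans (count-map P? here (map child (nodesF us)))
                  (count-map (λ v → P? (here v)) child (nodesF us)))
           (count-map P? there (nodesF ts)))) ⟩
  count P? (here root ∷ []) +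
    (count (λ i → P? (here (child i))) (nodesF us) + count (λ i → P? (there i)) (nodesF ts)) ∎
  where open ≡-Reasoning

#empty #nonempty : List X → ℕ
#empty []      = 1
#empty (_ ∷ _) = 0
#nonempty []      = 0
#nonempty (_ ∷ _) = 1

leavesF internalsF : List (Tree A) → ℕ
leavesF []                  = 0
leavesF (node _ us ∷ ts)    = #empty us + (leavesF us + leavesF ts)
internalsF []               = 0
internalsF (node _ us ∷ ts) = #nonempty us + (internalsF us + internalsF ts)

IsLeafF : Any (Node {A}) ts → Set
IsLeafF i = length (childrenF i) ≡ 0

isLeafF? : (i : Any (Node {A}) ts) → Dec (IsLeafF i)
isLeafF? i = length (childrenF i) ≟ 0

count-leavesF : (ts : List (Tree A)) → count isLeafF? (nodesF ts) ≡ leavesF ts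
count-leavesF []               = refl
count-leavesF (node a us ∷ ts) =
  trans (count-nodesF a us ts isLeafF?)
        (cong₂ _+_ (here-root us) (cong₂ _+_ (count-leavesF us) (count-leavesF ts)))
  where
  here-root : ∀ us → count isLeafF? (here {x = node a us} {xs = ts} root ∷ []) ≡ #empty us
  here-root []      = refl
  here-root (_ ∷ _) = refl

count-internalsF : (ts : List (Tree A)) → count (λ i → ¬? (isLeafF? i)) (nodesF ts) ≡ internalsF ts
count-internalsF []               = refl
count-internalsF (node a us ∷ ts) =
  trans (count-nodesF a us ts (λ i → ¬? (isLeafF? i)))
        (cong₂ _+_ (here-root us) (cong₂ _+_ (count-internalsF us) (count-internalsF ts)))
  where
  here-root : ∀ us → count (λ i → ¬? (isLeafF? i)) (here {x = node a us} {xs = ts} root ∷ []) ≡ #nonempty us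
  here-root []      = refl
  here-root (_ ∷ _) = refl

#empty-mirror : (ts : List (Tree A)) → #empty (mirrorF ts) ≡ #empty ts
#empty-mirror []             = refl
#empty-mirror (node _ _ ∷ _) = refl

-- Both sides count the absent right children in φF ts, an empty ts having one.
leavesF-mirror : (ts : List (Tree A)) → #empty ts + leavesF (mirrorF ts) ≡ suc (internalsF ts)
leavesF-mirror []               = refl
leavesF-mirror (node a us ∷ ts) = begin
  #empty (mirrorF ts) + (leavesF (mirrorF ts) + leavesF (mirrorF us))
    ≡⟨ cong (_+ (leavesF (mirrorF ts) + leavesF (mirrorF us))) (#empty-mirror ts) ⟩
  #empty ts + (leavesF (mirrorF ts) + leavesF (mirrorF us))
    ≡⟨ +-assoc (#empty ts) (leavesF (mirrorF ts)) (leavesF (mirrorF us)) ⟨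
  #empty ts + leavesF (mirrorF ts) + leavesF (mirrorF us)
    ≡⟨ cong₂ _+_ (leavesF-mirror ts) (cancel us (leavesF-mirror us)) ⟩
  suc (internalsF ts) + (#nonempty us + internalsF us)
    ≡⟨ cong suc (+-comm (internalsF ts) (#nonempty us + internalsF us)) ⟩
  suc (#nonempty us + internalsF us + internalsF ts)
    ≡⟨ cong suc (+-assoc (#nonempty us) (internalsF us) (internalsF ts)) ⟩
  suc (internalsF (node a us ∷ ts)) ∎
  where
  open ≡-Reasoning
  -- This rests on `#empty us + #nonempty us` being 1.
  cancel : ∀ us {m n} → #empty us + m ≡ suc n → m ≡ #nonempty us + n
  cancel []      eq = suc-injective eq
  cancel (_ ∷ _) eq = eq

-- Over a nonempty forest the root is internal. It adds one to the internal nodes only, which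
-- matches the `suc` in `leavesF-mirror`.
leaves-leavesF : ∀ (a : A) ts → ts ≢ [] → leaves (node a ts) ≡ leavesF ts
leaves-leavesF a []         ≢[] = contradiction refl ≢[]
leaves-leavesF a ts@(_ ∷ _) _   =
  trans (count-map {X = Node (node a ts)} isLeaf? child (nodesF ts)) (count-leavesF ts)

internals-internalsF : ∀ (a : A) ts → ts ≢ [] → internals (node a ts) ≡ suc (internalsF ts)
internals-internalsF a []         ≢[] = contradiction refl ≢[]
internals-internalsF a ts@(_ ∷ _) _   = cong suc
  (trans (count-map {X = Node (node a ts)} (λ v → ¬? (isLeaf? v)) child (nodesF ts)) (count-internalsF ts))

leaves-φ̃ : (t : Tree A) → subtrees t ≢ [] → leaves (φ̃ t) ≡ internals t
leaves-φ̃ (node a [])         ≢[] = contradiction refl ≢[]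
leaves-φ̃ (node a ts@(node _ _ ∷ _)) ≢[] = begin
  leaves (node a (mirrorF ts))     ≡⟨ leaves-leavesF a (mirrorF ts) (λ ()) ⟩
  leavesF (mirrorF ts)             ≡⟨ leavesF-mirror ts ⟩
  suc (internalsF ts)              ≡⟨ internals-internalsF a ts ≢[] ⟨
  internals (node a ts)            ∎
  where open ≡-Reasoning

-- Labels and weak increase under mirroring.

labelsF : List (Tree A) → List A
labelsF []               = []
labelsF (node a us ∷ ts) = a ∷ labelsF us ++ labelsF ts

labelsF-nodesF : (ts : List (Tree A)) → map labelF (nodesF ts) ≡ labelsF ts
labelsF-nodesF []               = refl
labelsF-nodesF (node a us ∷ ts) = trans (map-nodesF a us ts labelF)
  (cong (a ∷_) (cong₂ _++_ (labelsF-nodesF us) (labelsF-nodesF ts)))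

labels-labelsF : (a : A) (ts : List (Tree A)) → labels (node a ts) ≡ a ∷ labelsF ts
labels-labelsF a ts = cong (a ∷_) (trans (sym (map-∘ (nodesF ts))) (labelsF-nodesF ts))

labelsF-mirror : (ts : List (Tree A)) → labelsF (mirrorF ts) ↭ labelsF ts
labelsF-mirror []               = ↭-refl
labelsF-mirror (node a us ∷ ts) = prep a (↭-trans
  (++⁺ (labelsF-mirror ts) (labelsF-mirror us)) (++-comm (labelsF ts) (labelsF us)))

-- Weak increase from each node of φF ts to its children, p standing for the parent of the root.
Increasing : ℕ → List (Tree ℕ) → Set
Increasing p []               = ⊤
Increasing p (node a us ∷ ts) = p ≤ a × Increasing a us × Increasing a ts

increasing? : ∀ p ts → Dec (Increasing p ts)
increasing? p []               = yes tt
increasing? p (node a us ∷ ts) = p ≤? a ×-dec increasing? a us ×-dec increasing? a ts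

-- The condition is the same for left and right children, so mirroring only swaps two hypotheses.
increasing-mirror : ∀ {p} ts → Increasing p ts → Increasing p (mirrorF ts)
increasing-mirror []               _                  = tt
increasing-mirror (node a us ∷ ts) (p≤a , incᵘ , incᵗ) =
  p≤a , increasing-mirror ts incᵗ , increasing-mirror us incᵘ

-- Young leaves

youngLeafF? : (i : Any (Node {A}) ts) → Dec (length (childrenF i) ≡ 0 × length (youngerSiblingsF i) ≡ 0)
youngLeafF? i = (length (childrenF i) ≟ 0) ×-dec (length (youngerSiblingsF i) ≟ 0)

ifBothEmpty : A → List X → List Y → List A
ifBothEmpty a []      []      = a ∷ []
ifBothEmpty a []      (_ ∷ _) = []
ifBothEmpty a (_ ∷ _) _       = []

youngLeavesF : List (Tree A) → List A
youngLeavesF []               = []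
youngLeavesF (node a us ∷ ts) = ifBothEmpty a us ts ++ youngLeavesF us ++ youngLeavesF ts

select-youngLeaves : (ts : List (Tree A)) → select youngLeafF? labelF (nodesF ts) ≡ youngLeavesF ts
select-youngLeaves []               = refl
select-youngLeaves (node a us ∷ ts) = trans (select-nodesF a us ts youngLeafF? labelF)
  (cong₂ _++_ (here-root us ts) (cong₂ _++_ (select-youngLeaves us) (select-youngLeaves ts)))
  where
  here-root : ∀ us ts →
    select youngLeafF? labelF (here {x = node a us} {xs = ts} root ∷ []) ≡ ifBothEmpty a us ts
  here-root []      []      = refl
  here-root []      (_ ∷ _) = refl
  here-root (_ ∷ _) _       = refl

Yle-youngLeavesF : ∀ a ts → Yle (node a ts) ≡ youngLeavesF ts
Yle-youngLeavesF a ts = begin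
  Yle (node a ts)
    ≡⟨ select-root youngLeaf? label (λ (_ , 0<0 , _) → n≮0 0<0) ⟩
  select (λ i → youngLeaf? (child {a = a} i)) labelF (nodesF ts)
    ≡⟨ cong (map labelF) (filter-≐ (λ i → youngLeaf? (child {a = a} i)) youngLeafF?
         ((λ (l , _ , y) → l , y) , λ {i} (l , y) → l , subst (0 <_) (sym (lev-child {a = a} i)) z<s , y)
         (nodesF ts)) ⟩
  select youngLeafF? labelF (nodesF ts)
    ≡⟨ select-youngLeaves ts ⟩
  youngLeavesF ts ∎
  where open ≡-Reasoning

youngLeavesF-mirror : (ts : List (Tree A)) → youngLeavesF (mirrorF ts) ↭ youngLeavesF ts
youngLeavesF-mirror []               = ↭-refl
youngLeavesF-mirror (node a us ∷ ts) = ++⁺ (↭-reflexive (ifBothEmpty-mirror us ts)) (↭-trans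
  (++⁺ (youngLeavesF-mirror ts) (youngLeavesF-mirror us)) (++-comm (youngLeavesF ts) (youngLeavesF us)))
  where
  ifBothEmpty-mirror : ∀ us ts → ifBothEmpty a (mirrorF ts) (mirrorF us) ≡ ifBothEmpty a us ts
  ifBothEmpty-mirror []             []             = refl
  ifBothEmpty-mirror []             (node _ _ ∷ _) = refl
  ifBothEmpty-mirror (node _ _ ∷ _) []             = refl
  ifBothEmpty-mirror (node _ _ ∷ _) (node _ _ ∷ _) = refl

Yle-φ̃ : (t : Tree ℕ) → Yle (φ̃ t) ↭ Yle t
Yle-φ̃ (node a ts) = begin
  Yle (node a (mirrorF ts))     ≡⟨ Yle-youngLeavesF a (mirrorF ts) ⟩
  youngLeavesF (mirrorF ts)     ↭⟨ youngLeavesF-mirror ts ⟩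
  youngLeavesF ts               ≡⟨ Yle-youngLeavesF a ts ⟨
  Yle (node a ts)               ∎
  where open PermutationReasoning

-- Repeated siblings and repeated parents

-- As labels increase from left to right, a node has an elder sibling, or a child, with its own
-- label only if its closest elder sibling, or its leftmost child, has this label.
ifHeadLabelled : ℕ → List (Tree ℕ) → List ℕ
ifHeadLabelled a []             = []
ifHeadLabelled a (node b _ ∷ _) = filter (_≟ a) (b ∷ [])

-- The first inspects the right edges of `φF ts` and the second the left edges. Both record the
-- label at the lower end, which for a repeated parent equals its own.
repeatedSiblingsF repeatedParentsF : List (Tree ℕ) → List ℕ
repeatedSiblingsF []               = []
repeatedSiblingsF (node a us ∷ ts) = repeatedSiblingsF us ++ ifHeadLabelled a ts ++ repeatedSiblingsF ts
repeatedParentsF []               = []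
repeatedParentsF (node a us ∷ ts) = ifHeadLabelled a us ++ repeatedParentsF us ++ repeatedParentsF ts

repeatedSiblingsF-mirror : ∀ ts → repeatedSiblingsF (mirrorF ts) ↭ repeatedParentsF ts
repeatedSiblingsF-mirror []               = ↭-refl
repeatedSiblingsF-mirror (node a us ∷ ts) = begin
  repeatedSiblingsF (mirrorF ts) ++ ifHeadLabelled a (mirrorF us) ++ repeatedSiblingsF (mirrorF us)
    ↭⟨ ++⁺ (repeatedSiblingsF-mirror ts)
           (++⁺ (↭-reflexive (ifHeadLabelled-mirror us)) (repeatedSiblingsF-mirror us)) ⟩
  repeatedParentsF ts ++ ifHeadLabelled a us ++ repeatedParentsF us
    ↭⟨ ++-comm (repeatedParentsF ts) _ ⟩
  (ifHeadLabelled a us ++ repeatedParentsF us) ++ repeatedParentsF ts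
    ≡⟨ ++-assoc (ifHeadLabelled a us) (repeatedParentsF us) (repeatedParentsF ts) ⟩
  ifHeadLabelled a us ++ repeatedParentsF us ++ repeatedParentsF ts ∎
  where
  open PermutationReasoning
  ifHeadLabelled-mirror : ∀ us → ifHeadLabelled a (mirrorF us) ≡ ifHeadLabelled a us
  ifHeadLabelled-mirror []             = refl
  ifHeadLabelled-mirror (node _ _ ∷ _) = refl

-- Only when the tests succeed must `y` agree with `f x`; for repeated parents `y` is the label of
-- the child.
select-singleton : {P : Pred X 0ℓ} (P? : Decidable P) (f : X → Y) {Q : Pred Y 0ℓ} (Q? : Decidable Q) →
  ∀ x y → (P x → Q y × y ≡ f x) → (Q y → P x) → select P? f (x ∷ []) ≡ filter Q? (y ∷ [])
select-singleton P? f Q? x y P⇒Q Q⇒P with P? x | Q? y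
... | yes p | yes _ = cong (_∷ []) (sym (proj₂ (P⇒Q p)))
... | no  _ | no  _ = refl
... | yes p | no ¬q = contradiction (proj₁ (P⇒Q p)) ¬q
... | no ¬p | yes q = contradiction (Q⇒P q) ¬p

repeatedSiblingF? : ∀ es (i : Any (Node {ℕ}) ts) →
  Dec (Any (λ s → rootLabel s ≡ labelF i) (elderSiblingsF es i))
repeatedSiblingF? es i = any? (λ s → rootLabel s ≟ labelF i) (elderSiblingsF es i)

repeatedParentF? : (i : Any (Node {ℕ}) ts) → Dec (Any (λ s → rootLabel s ≡ labelF i) (childrenF i))
repeatedParentF? i = any? (λ s → rootLabel s ≟ labelF i) (childrenF i)

-- The second claim describes a forest whose closest elder tree is `t`, with all earlier ones
-- bounded by its label. The claims are proved together because below each node the list of elders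
-- starts empty again.
select-repeatedSiblings : ∀ ts →
  (∀ {p} → Increasing p ts → select (repeatedSiblingF? []) labelF (nodesF ts) ≡ repeatedSiblingsF ts) ×
  (∀ es t → All (λ e → rootLabel e ≤ rootLabel t) es → Increasing (rootLabel t) ts →
    select (repeatedSiblingF? (es ∷ʳ t)) labelF (nodesF ts) ≡ ifHeadLabelled (rootLabel t) ts ++ repeatedSiblingsF ts)
select-repeatedSiblings []               = (λ _ → refl) , λ _ _ _ _ → refl
select-repeatedSiblings (node a us ∷ ts) = eldest , younger
  where
  tail : ∀ es → All (λ e → rootLabel e ≤ a) es → Increasing a us → Increasing a ts →
    select (repeatedSiblingF? []) labelF (nodesF us) ++ select (repeatedSiblingF? (es ∷ʳ node a us)) labelF (nodesF ts)
      ≡ repeatedSiblingsF (node a us ∷ ts)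
  tail es es≤a incᵘ incᵗ = cong₂ _++_ (proj₁ (select-repeatedSiblings us) incᵘ)
    (proj₂ (select-repeatedSiblings ts) es (node a us) es≤a incᵗ)

  eldest : ∀ {p} → Increasing p (node a us ∷ ts) →
    select (repeatedSiblingF? []) labelF (nodesF (node a us ∷ ts)) ≡ repeatedSiblingsF (node a us ∷ ts)
  eldest (p≤a , incᵘ , incᵗ) =
    trans (select-nodesF a us ts (repeatedSiblingF? []) labelF) (tail [] [] incᵘ incᵗ)

  here-root : ∀ es t → All (λ e → rootLabel e ≤ rootLabel t) es → rootLabel t ≤ a →
    select (repeatedSiblingF? (es ∷ʳ t)) labelF (here {x = node a us} {xs = ts} root ∷ [])
      ≡ filter (_≟ rootLabel t) (a ∷ [])
  here-root es t es≤t t≤a = select-singleton (repeatedSiblingF? (es ∷ʳ t)) labelF (_≟ rootLabel t) (here root) a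
    -- An elder `e` with label `a` gives `a ≤ rootLabel t`, the converse of `t≤a`.
    (λ p → let e≤t , e≡a = All.lookupAny (All.∷ʳ⁺ es≤t ≤-refl) p in
           ≤-antisym (subst (_≤ rootLabel t) e≡a e≤t) t≤a , refl)
    (λ a≡t → Any.++⁺ʳ es (here (sym a≡t)))

  younger : ∀ es t → All (λ e → rootLabel e ≤ rootLabel t) es → Increasing (rootLabel t) (node a us ∷ ts) →
    select (repeatedSiblingF? (es ∷ʳ t)) labelF (nodesF (node a us ∷ ts)) ≡
    filter (_≟ rootLabel t) (a ∷ []) ++ repeatedSiblingsF (node a us ∷ ts)
  younger es t es≤t (t≤a , incᵘ , incᵗ) =
    trans (select-nodesF a us ts (repeatedSiblingF? (es ∷ʳ t)) labelF) (cong₂ _++_ (here-root es t es≤t t≤a)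
      (tail (es ∷ʳ t) (All.∷ʳ⁺ (All.map (λ e≤t → ≤-trans e≤t t≤a) es≤t) t≤a) incᵘ incᵗ))

increasing⇒rootLabel≥ : ∀ {p} ts → Increasing p ts → All (λ t → p ≤ rootLabel t) ts
increasing⇒rootLabel≥ []               _                = []
increasing⇒rootLabel≥ (node a us ∷ ts) (p≤a , _ , incᵗ) =
  p≤a ∷ All.map (≤-trans p≤a) (increasing⇒rootLabel≥ ts incᵗ)

select-repeatedParents : ∀ {p} ts → Increasing p ts →
  select repeatedParentF? labelF (nodesF ts) ≡ repeatedParentsF ts
select-repeatedParents []               _                = refl
select-repeatedParents (node a us ∷ ts) (_ , incᵘ , incᵗ) = trans
  (select-nodesF a us ts repeatedParentF? labelF)
  (cong₂ _++_ (here-root us incᵘ) (cong₂ _++_ (select-repeatedParents us incᵘ) (select-repeatedParents ts incᵗ)))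
  where
  here-root : ∀ us → Increasing a us →
    select repeatedParentF? labelF (here {x = node a us} {xs = ts} root ∷ []) ≡ ifHeadLabelled a us
  here-root []                 _   = refl
  here-root (node b vs ∷ us) (a≤b , _ , inc) = select-singleton repeatedParentF? labelF (_≟ a) (here root) b
    -- Any child labelled `a` is at least the leftmost label `b`, which in turn is at least `a`.
    (λ p → let b≤e , e≡a = All.lookupAny (≤-refl ∷ increasing⇒rootLabel≥ us inc) p
               b≡a = ≤-antisym (subst (b ≤_) e≡a b≤e) a≤b
           in b≡a , b≡a)
    here

Bro-repeatedSiblingsF : ∀ {a ts} → Increasing a ts → Bro (node a ts) ≡ repeatedSiblingsF ts
Bro-repeatedSiblingsF {a} {ts} inc = trans (select-root {a = a} repeatedSibling? label λ ())
  (proj₁ (select-repeatedSiblings ts) inc)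

-- The strict bound keeps the root from being a repeated parent; it could not be matched by a
-- repeated sibling.
Par-repeatedParentsF : ∀ {a ts} → Increasing a ts → All (λ t → a < rootLabel t) ts →
  Par (node a ts) ≡ repeatedParentsF ts
Par-repeatedParentsF {a} {ts} inc a<ts = trans
  (select-root {a = a} repeatedParent? label λ p → let a<e , e≡a = All.lookupAny a<ts p in <⇒≢ a<e (sym e≡a))
  (select-repeatedParents ts inc)

-- Weakly increasing trees

downLabels : Any (Node {A}) ts → List A
downLabels (here {x = t} root)             = rootLabel t ∷ []
downLabels (here (child {a = a} i))        = a ∷ downLabels i
downLabels (there i)                       = downLabels i

reverse-climbF : (i : Any (Node {A}) ts) → reverse (map labelF (climbF i)) ≡ downLabels i
reverse-climbF (here root) = refl
reverse-climbF (here {xs = ts} (child {a = a} {ts = us} i)) = begin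
  reverse (map labelF (map hereChild (climbF i) ∷ʳ here root))
    ≡⟨ cong reverse (map-++ labelF (map hereChild (climbF i)) (here root ∷ [])) ⟩
  reverse (map labelF (map hereChild (climbF i)) ∷ʳ a)
    ≡⟨ reverse-++ (map labelF (map hereChild (climbF i))) (a ∷ []) ⟩
  a ∷ reverse (map labelF (map hereChild (climbF i)))
    ≡⟨ cong (λ as → a ∷ reverse as) (map-∘ (climbF i)) ⟨
  a ∷ reverse (map labelF (climbF i))
    ≡⟨ cong (a ∷_) (reverse-climbF i) ⟩
  a ∷ downLabels i ∎
  where
  open ≡-Reasoning
  hereChild : Any Node us → Any Node (node a us ∷ ts)
  hereChild j = here (child j)
reverse-climbF (there i) = trans (cong reverse (sym (map-∘ (climbF i)))) (reverse-climbF i)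

path-downLabels : ∀ {a} (i : Any (Node {A}) ts) →
  map label (reverse (pathToRoot (child {a = a} i))) ≡ a ∷ downLabels i
path-downLabels {a = a} i = begin
  map label (reverse (map child (climbF i) ∷ʳ root))
    ≡⟨ cong (map label) (reverse-++ (map child (climbF i)) (root ∷ [])) ⟩
  a ∷ map label (reverse (map child (climbF i)))
    ≡⟨ cong (a ∷_) (reverse-map label (map child (climbF i))) ⟩
  a ∷ reverse (map label (map child (climbF i)))
    ≡⟨ cong (λ as → a ∷ reverse as) (map-∘ (climbF i)) ⟨
  a ∷ reverse (map labelF (climbF i))
    ≡⟨ cong (a ∷_) (reverse-climbF i) ⟩
  a ∷ downLabels i ∎
  where open ≡-Reasoning

increasing⇒paths : ∀ {p ts} → Increasing p ts → (i : Any Node ts) → Linked _≤_ (p ∷ downLabels i)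
increasing⇒paths {ts = node a us ∷ ts} (p≤a , _    , _)    (here root)      = p≤a ∷ [-]
increasing⇒paths {ts = node a us ∷ ts} (p≤a , incᵘ , _)    (here (child i)) = p≤a ∷ increasing⇒paths incᵘ i
increasing⇒paths {ts = node a us ∷ ts} (p≤a , _    , incᵗ) (there i)
  -- The path bypasses `node a us`, so its first label is compared with `p` through `a`.
  with downLabels i | increasing⇒paths incᵗ i
... | []    | _             = [-]
... | _ ∷ _ | a≤b ∷ linked  = ≤-trans p≤a a≤b ∷ linked

increasing⇒siblings : ∀ {p ts} → Increasing p ts → Linked _≤_ (p ∷ map rootLabel ts)
increasing⇒siblings {ts = []}             _               = [-]
increasing⇒siblings {ts = node a us ∷ ts} (p≤a , _ , inc) = p≤a ∷ increasing⇒siblings inc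

increasing⇒siblingsF : ∀ {p ts} → Increasing p ts → (i : Any Node ts) →
  Linked _≤_ (map rootLabel (childrenF i))
increasing⇒siblingsF {ts = node a us ∷ ts} (_ , inc , _) (here root)      = Linked.tail (increasing⇒siblings inc)
increasing⇒siblingsF {ts = node a us ∷ ts} (_ , inc , _) (here (child i)) = increasing⇒siblingsF inc i
increasing⇒siblingsF {ts = node a us ∷ ts} (_ , _ , inc) (there i)        = increasing⇒siblingsF inc i

-- The path condition speaks of leaves only. Following leftmost children gives a leaf whose path
-- passes through the root of `t`.
leafBelow : (t : Tree A) (ts : List (Tree A)) →
  ∃ λ (i : Any Node (t ∷ ts)) → IsLeafF i × ∃ λ as → downLabels i ≡ rootLabel t ∷ as
leafBelow (node a [])       ts = here root , refl , [] , refl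
leafBelow (node a (u ∷ us)) ts with i , l , _ ← leafBelow u us =
  here (child i) , l , downLabels i , refl

firstChild≥ : ∀ {a} ts → Linked _≤_ (map rootLabel ts) →
  (∀ (i : Any Node ts) → IsLeafF i → Linked _≤_ (a ∷ downLabels i)) → Linked _≤_ (a ∷ map rootLabel ts)
firstChild≥ {a} []       _      _     = [-]
firstChild≥ {a} (t ∷ ts) sorted paths with i , l , as , eq ← leafBelow t ts =
  Linked.head (subst (λ bs → Linked _≤_ (a ∷ bs)) eq (paths i l)) ∷ sorted

-- Paths to leaves give the inequality along each left edge, and sorted siblings give it along each
-- right edge.
paths⇒increasing : ∀ {p} ts → Linked _≤_ (p ∷ map rootLabel ts) →
  (∀ (i : Any Node ts) → IsLeafF i → Linked _≤_ (downLabels i)) →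
  (∀ (i : Any Node ts) → Linked _≤_ (map rootLabel (childrenF i))) → Increasing p ts
paths⇒increasing []               _              _     _        = tt
paths⇒increasing (node a us ∷ ts) (p≤a ∷ sorted) paths siblings =
  p≤a ,
  paths⇒increasing us
    (firstChild≥ us (siblings (here root)) (λ i → paths (here (child i))))
    (λ i l → Linked.tail (paths (here (child i)) l))
    (λ i → siblings (here (child i))) ,
  paths⇒increasing ts sorted (λ i → paths (there i)) (λ i → siblings (there i))

increasing⇒All≥ : ∀ {p} ts → Increasing p ts → All (p ≤_) (labelsF ts)
increasing⇒All≥ []               _                   = []
increasing⇒All≥ (node a us ∷ ts) (p≤a , incᵘ , incᵗ) =
  p≤a ∷ All.map (≤-trans p≤a) (All.++⁺ (increasing⇒All≥ us incᵘ) (increasing⇒All≥ ts incᵗ))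

-- An equivalent form of `WeaklyIncreasing` that is decidable by recursion and clearly stable under
-- mirroring.
Canonical : List ℕ → Tree ℕ → Set
Canonical M (node a ts) = a ≡ 0 × labelsF ts ↭ M × Increasing 0 ts

weaklyIncreasing⇒canonical : ∀ T → WeaklyIncreasing M T → Canonical M T
weaklyIncreasing⇒canonical {M} (node a ts) wi = a≡0 , labelled′ , subst (λ p → Increasing p ts) a≡0 increasing
  where
  open WeaklyIncreasing wi
  paths′ : ∀ i → IsLeafF i → Linked _≤_ (a ∷ downLabels i)
  paths′ i l = subst (Linked _≤_) (path-downLabels i) (paths (child i) l)

  increasing : Increasing a ts
  increasing = paths⇒increasing ts (firstChild≥ ts (siblings root) paths′)
    (λ i l → Linked.tail (paths′ i l)) (λ i → siblings (child i))

  a∷labels↭0∷M : a ∷ labelsF ts ↭ 0 ∷ M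
  a∷labels↭0∷M = subst (_↭ 0 ∷ M) (labels-labelsF a ts) labelled

  a≡0 : a ≡ 0
  -- The root label is the least one, and 0 occurs among the labels.
  a≡0 = n≤0⇒n≡0 (All.lookup (≤-refl ∷ increasing⇒All≥ ts increasing) (∈-resp-↭ (↭-sym a∷labels↭0∷M) (here refl)))

  labelled′ : labelsF ts ↭ M
  labelled′ = drop-∷ (subst (λ b → b ∷ labelsF ts ↭ 0 ∷ M) a≡0 a∷labels↭0∷M)

canonical⇒weaklyIncreasing : ∀ T → Canonical M T → WeaklyIncreasing M T
canonical⇒weaklyIncreasing {M} (node a ts) (refl , labelled , inc) = record
  { labelled = subst (_↭ 0 ∷ M) (sym (labels-labelsF 0 ts)) (prep 0 labelled)
  ; paths    = λ { root      _ → [-]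
                 ; (child i) _ → subst (Linked _≤_) (sym (path-downLabels i)) (increasing⇒paths inc i) }
  ; siblings = λ { root      → Linked.tail (increasing⇒siblings inc)
                 ; (child i) → increasing⇒siblingsF inc i }
  }

φ̃-canonical : ∀ T → Canonical M T → Canonical M (φ̃ T)
φ̃-canonical (node a ts) (a≡0 , labelled , inc) =
  a≡0 , ↭-trans (labelsF-mirror ts) labelled , increasing-mirror ts inc

φ̃-weaklyIncreasing : ∀ {T} → WeaklyIncreasing M T → WeaklyIncreasing M (φ̃ T)
φ̃-weaklyIncreasing {T = T} wi =
  canonical⇒weaklyIncreasing (φ̃ T) (φ̃-canonical T (weaklyIncreasing⇒canonical T wi))

-- Decidability and finiteness.

_↭?_ : (xs ys : List ℕ) → Dec (xs ↭ ys)
[]       ↭? []      = yes ↭-refl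
[]       ↭? (_ ∷ _) = no λ p → 0≢1+n (↭-length p)
(x ∷ xs) ↭? ys with _∈?_ _≟_ x ys
... | no x∉ys  = no λ p → x∉ys (∈-resp-↭ p (here refl))
... | yes x∈ys with us , vs , refl ← ∈-∃++ x∈ys =
  map′ (λ p → ↭-trans (prep x p) (↭-sym (Perm.shift x us vs)))
       (λ p → drop-∷ (↭-trans p (Perm.shift x us vs)))
       (xs ↭? (us ++ vs))

canonical? : ∀ M T → Dec (Canonical M T)
canonical? M (node a ts) = (a ≟ 0) ×-dec (labelsF ts ↭? M) ×-dec increasing? 0 ts

weaklyIncreasing? : ∀ M → Decidable (WeaklyIncreasing M)
weaklyIncreasing? M T = map′ (canonical⇒weaklyIncreasing T) (weaklyIncreasing⇒canonical T) (canonical? M T)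

mutual
  _≟ᵗ_ : DecidableEquality (Tree ℕ)
  node a ts ≟ᵗ node b us =
    map′ (λ { (refl , refl) → refl }) (λ { refl → refl , refl }) ((a ≟ b) ×-dec (ts ≟ᶠ us))

  _≟ᶠ_ : DecidableEquality (List (Tree ℕ))
  []       ≟ᶠ []       = yes refl
  []       ≟ᶠ (_ ∷ _)  = no λ ()
  (_ ∷ _)  ≟ᶠ []       = no λ ()
  (t ∷ ts) ≟ᶠ (u ∷ us) =
    map′ (λ { (refl , refl) → refl }) (λ { refl → refl , refl }) ((t ≟ᵗ u) ×-dec (ts ≟ᶠ us))

-- The fuel k bounds the height of φF ts, hence is large enough when ts has at most k nodes.
forests : List ℕ → ℕ → List (List (Tree ℕ))
forests S zero    = [] ∷ []
forests S (suc k) = [] ∷ cartesianProductWith (λ a (us , ts) → node a us ∷ ts) S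
  (cartesianProduct (forests S k) (forests S k))

∈-forests : ∀ {S k} ts → All (_∈ S) (labelsF ts) → length (labelsF ts) ≤ k → ts ∈ forests S k
∈-forests {k = zero}  []               _          _         = here refl
∈-forests {k = suc k} []               _          _         = here refl
∈-forests {k = zero}  (node _ _ ∷ _)   _          ()
∈-forests {S} {suc k} (node a us ∷ ts) (a∈S ∷ ∈S) (s≤s len) = there (∈-cartesianProductWith⁺ _ a∈S
  (∈-cartesianProduct⁺
    (∈-forests us (All.++⁻ˡ (labelsF us) ∈S) (≤-trans (length-++-≤ˡ (labelsF us)) len))
    (∈-forests ts (All.++⁻ʳ (labelsF us) ∈S) (≤-trans (length-++-≤ʳ (labelsF ts) {labelsF us}) len))))

trees : List ℕ → List (Tree ℕ)
trees M = map (node 0) (forests M (length M))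

∈-trees : ∀ {T} → WeaklyIncreasing M T → T ∈ trees M
∈-trees {M} {T} wi with node .0 ts ← T | refl , labelled , _ ← weaklyIncreasing⇒canonical T wi =
  ∈-map⁺ (node 0) (∈-forests ts
    (All-resp-↭ (↭-sym labelled) (All.tabulate id))
    (≤-reflexive (↭-length labelled)))

-- The list `xs` may contain repetitions and elements outside `P`; filtering and deduplication
-- remove both.
finite⇒hasCardinality : {P : Pred X 0ℓ} → DecidableEquality X → Decidable P →
  (xs : List X) → (∀ {x} → P x → x ∈ xs) → ∃ (HasCardinality P)
finite⇒hasCardinality _≟_ P? xs P⊆xs = _ , deduplicate _≟_ (filter P? xs) ,
  DecUnique.deduplicate-! _≟_ (filter P? xs) ,
  (λ x → mk⇔ (λ x∈ → proj₂ (∈-filter⁻ P? {xs = xs} (∈-deduplicate⁻ _≟_ (filter P? xs) x∈)))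
             (λ px → ∈-deduplicate⁺ _≟_ (∈-filter⁺ P? (P⊆xs px) px))) ,
  refl

-- The image under `ι` of a list for `P` is one for `Q`: an involution is injective, and each `y` in
-- `Q` is the image of `ι y`.
involution⇒hasCardinality : {P Q : Pred X 0ℓ} (ι : X → X) → (∀ x → ι (ι x) ≡ x) →
  (∀ {x} → P x → Q (ι x)) → (∀ {x} → Q x → P (ι x)) → ∀ {k} → HasCardinality P k → HasCardinality Q k
involution⇒hasCardinality {P = P} {Q} ι ιι P⇒Q Q⇒P (xs , unique , ∈⇔P , refl) =
  map ι xs ,
  Unique.map⁺ (λ {x} {y} eq → trans (sym (ιι x)) (trans (cong ι eq) (ιι y))) unique ,
  (λ y → mk⇔ (to y) (λ qy → subst (_∈ map ι xs) (ιι y) (∈-map⁺ ι (Equivalence.from (∈⇔P (ι y)) (Q⇒P qy))))) ,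
  length-map ι xs
  where
  to : ∀ y → y ∈ map ι xs → Q y
  to y y∈ with x , x∈ , refl ← ∈-map⁻ ι y∈ = P⇒Q (Equivalence.to (∈⇔P x) x∈)

-- Equidistribution of the septuples.

septuple septuple′ : Tree ℕ → Setoid.Carrier Septuples
septuple  T = Lev T , Lsw T , Bro T , Par T , Yle T , leaves T , internals T
septuple′ T = Lsw T , Lev T , Par T , Bro T , Yle T , internals T , leaves T

open Setoid Septuples using (_≈_) renaming (sym to ≈-sym; trans to ≈-trans)

_≈?_ : (v w : Setoid.Carrier Septuples) → Dec (v ≈ w)
(a , b , c , d , e , f , g) ≈? (a′ , b′ , c′ , d′ , e′ , f′ , g′) =
  (a ↭? a′) ×-dec (b ↭? b′) ×-dec (c ↭? c′) ×-dec (d ↭? d′) ×-dec (e ↭? e′) ×-dec (f ≟ f′) ×-dec (g ≟ g′)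

module _ {M : List ℕ} (M≢[] : M ≢ []) (M>0 : All (0 <_) M) where

  Bro-φ̃ : ∀ {T} → WeaklyIncreasing M T → Bro (φ̃ T) ↭ Par T
  Bro-φ̃ {T} wi with node a ts ← T | refl , labelled , inc ← weaklyIncreasing⇒canonical T wi = begin
    Bro (node 0 (mirrorF ts))         ≡⟨ Bro-repeatedSiblingsF (increasing-mirror ts inc) ⟩
    repeatedSiblingsF (mirrorF ts)    ↭⟨ repeatedSiblingsF-mirror ts ⟩
    repeatedParentsF ts               ≡⟨ Par-repeatedParentsF inc (rootLabels>0 ts (All-resp-↭ (↭-sym labelled) M>0)) ⟨
    Par (node 0 ts)                   ∎
    where
    open PermutationReasoning
    rootLabels>0 : ∀ ts → All (0 <_) (labelsF ts) → All (λ t → 0 < rootLabel t) ts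
    rootLabels>0 []               _         = []
    rootLabels>0 (node a us ∷ ts) (0<a ∷ p) = 0<a ∷ rootLabels>0 ts (All.++⁻ʳ (labelsF us) p)

  subtrees≢[] : ∀ T → WeaklyIncreasing M T → subtrees T ≢ []
  subtrees≢[] T@(node a ts) wi refl with _ , labelled , _ ← weaklyIncreasing⇒canonical T wi =
    M≢[] (↭-empty-inv (↭-sym labelled))

  -- The components `Lsw`, `Par` and `internals` follow from those for `Lev`, `Bro` and `leaves` at
  -- `φ̃ T`, as `φ̃` is an involution.
  septuple-φ̃ : ∀ {T} → WeaklyIncreasing M T → septuple (φ̃ T) ≈ septuple′ T
  septuple-φ̃ {T} wi =
    Lev-φ̃ T , ↭-sym (back Lev Lsw Lev-φ̃) ,
    Bro-φ̃ wi , ↭-sym (subst (λ S → Bro S ↭ Par (φ̃ T)) (φ̃-involutive T) (Bro-φ̃ wi′)) ,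
    Yle-φ̃ T ,
    leaves-φ̃ T (subtrees≢[] T wi) ,
    sym (subst (λ S → leaves S ≡ internals (φ̃ T)) (φ̃-involutive T) (leaves-φ̃ (φ̃ T) (subtrees≢[] (φ̃ T) wi′)))
    where
    wi′ = φ̃-weaklyIncreasing wi
    back : (f g : Tree ℕ → List ℕ) → (∀ t → f (φ̃ t) ↭ g t) → f T ↭ g (φ̃ T)
    back f g p = subst (λ S → f S ↭ g (φ̃ T)) (φ̃-involutive T) (p (φ̃ T))

  septuples-sameDistribution : SameDistribution Septuples (WeaklyIncreasing M) septuple septuple′
  septuples-sameDistribution w = k , card , involution⇒hasCardinality {P = P} {Q = Q} φ̃ φ̃-involutive
    -- Here `septuple-φ̃` is taken at `φ̃ T`, whose image under `φ̃` is `T` again.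
    (λ {T} (wi , eq) → φ̃-weaklyIncreasing wi , ≈-trans (≈-sym (septuple-φ̃ (φ̃-weaklyIncreasing wi)))
                          (subst (λ S → septuple S ≈ w) (sym (φ̃-involutive T)) eq))
    (λ (wi , eq) → φ̃-weaklyIncreasing wi , ≈-trans (septuple-φ̃ wi) eq)
    card
    where
    P Q : Pred (Tree ℕ) 0ℓ
    P T = WeaklyIncreasing M T × septuple T ≈ w
    Q T = WeaklyIncreasing M T × septuple′ T ≈ w

    finite : ∃ (HasCardinality P)
    finite = finite⇒hasCardinality _≟ᵗ_
      (λ T → weaklyIncreasing? M T ×-dec (septuple T ≈? w)) (trees M) (λ (wi , _) → ∈-trees wi)

    k = proj₁ finite
    card = proj₂ finite

multiset>0 : ∀ n p → All (0 <_) (multiset n p)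
multiset>0 n p = All.concat⁺ (All.map⁺ (All.universal (λ i → All.replicate⁺ (p i) z<s) (allFin n)))

multiset≢[] : ∀ n p → 1 ≤ n → (∀ i → 1 ≤ p i) → multiset n p ≢ []
multiset≢[] (suc n) p _ 1≤p eq with p zero | 1≤p zero
multiset≢[] (suc n) p _ 1≤p () | suc _ | _

theorem2p5 : ∀ (n : ℕ) (p : Fin n → ℕ) → 1 ≤ n → (∀ i → 1 ≤ p i) →
    (∀ (T : Tree ℕ) → WeaklyIncreasing (multiset n p) T →
    ∀ (v u : Node T) → v ⇝ u →
    (lev v ≡ lsw (φ̃-node u)) × (lsw v ≡ lev (φ̃-node u)) × (deg v ≡ d̃eg (φ̃-node u)))
    × SameDistribution Septuples (WeaklyIncreasing (multiset n p))
    (λ T → Lev T , Lsw T , Bro T , Par T , Yle T , leaves T , internals T)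
    (λ T → Lsw T , Lev T , Par T , Bro T , Yle T , internals T , leaves T)
theorem2p5 n p 1≤n 1≤p =
  (λ T _ v u v⇝u → ⇝-stats v⇝u) ,
  septuples-sameDistribution (multiset≢[] n p 1≤n 1≤p) (multiset>0 n p)
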